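{- For all rational numbers $f,g,d$, define $$\begin{aligned} x_1&=(6f^2+12fg+6g^2+d)(-30f^2+4fg+2g^2+d),\\ x_2&=(-6f^2+4fg+10g^2+d)(30f^2-4fg-2g^2+d),\\ x_3&=(18f^2+20fg+2g^2+d)(-18f^2+12fg-2g^2+d),\\ x_4&=(6f^2-4fg-10g^2+d)(18f^2-12fg+2g^2+d),\\ x_5&=(-6f^2+20fg-6g^2+d)(-18f^2-20fg-2g^2+d),\\ x_6&=(6f^2-20fg+6g^2+d)(-6f^2-12fg-6g^2+d),\\ y_1&=(-18f^2+12fg-2g^2+d)(-6f^2+4fg+10g^2+d),\\ y_2&=(6f^2-20fg+6g^2+d)(18f^2+20fg+2g^2+d),\\ y_3&=(-6f^2+20fg-6g^2+d)(6f^2+12fg+6g^2+d),\\ y_4&=(30f^2-4fg-2g^2+d)(-6f^2-12fg-6g^2+d),\\ y_5&=(-30f^2+4fg+2g^2+d)(6f^2-4fg-10g^2+d),\\ y_6&=(18f^2-12fg+2g^2+d)(-18f^2-20fg-2g^2+d). \end{aligned}$$ Then $$\sum_{i=1}^6x_i^r=\sum_{i=1}^6y_i^r\quad\text{for } r=1,2,3,4,\qquad\text{and}\qquad \prod_{i=1}^6x_i=\prod_{i=1}^6y_i.$$ Moreover, as a parametric solution this is nontrivial: in $\mathbb{Q}[f,g,d]$ the multisets $\{x_1,\dots,x_6\}$ and $\{y_1,\dots,y_6\}$ are distinct. -}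

module Defs where

open import Agda.Builtin.FromNat using (Number; fromNat)
open import Agda.Builtin.FromNeg using (Negative; fromNeg)
open import Algebra.Bundles using (RawRing)
open import Data.List.Base using (List; []; _∷_; map)
open import Data.Nat.Base using (ℕ; zero; suc)
import Data.Nat.Literals as ℕ
open import Data.Rational.Base using (ℚ; +-*-rawRing)
import Data.Rational.Literals as ℚ
open import Data.Unit.Base using (⊤; tt)
open import Data.Vec.Functional using (Vector; fromList)
open import Level using (Level; 0ℓ)
open import Relation.Binary.Bundles using (Setoid)
open import Relation.Binary.Structures using (IsEquivalence)
import Relation.Binary.PropositionalEquality as ≡
import Algebra.Definitions.RawSemiring as RawSemiringDefinitions

private
  variable
    a ℓ : Level

  instance
    numberℕ : Number ℕ
    numberℕ = ℕ.number

    numberℚ : Number ℚ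
    numberℚ = ℚ.number

    negativeℚ : Negative ℚ
    negativeℚ = ℚ.negative

-- A list c₀ ∷ c₁ ∷ … ∷ cₙ ∷ [] stands for c₀ + c₁X + … + cₙXⁿ.  Trailing
-- zeros are allowed, so polynomials are compared by their coefficients
-- and not as lists.

module Polynomial (R : RawRing a ℓ) where

  open RawRing R

  Poly : Set a
  Poly = List Carrier

  coeff : Poly → ℕ → Carrier
  coeff []      _       = 0#
  coeff (c ∷ p) zero    = c
  coeff (c ∷ p) (suc n) = coeff p n

  infix 4 _≈ₚ_
  _≈ₚ_ : Poly → Poly → Set ℓ
  p ≈ₚ q = ∀ n → coeff p n ≈ coeff q n

  infixl 6 _+ₚ_
  _+ₚ_ : Poly → Poly → Poly
  []      +ₚ q       = q
  (c ∷ p) +ₚ []      = c ∷ p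
  (c ∷ p) +ₚ (e ∷ q) = (c + e) ∷ (p +ₚ q)

  -- (c + X p) q = c q + X (p q)
  infixl 7 _*ₚ_
  _*ₚ_ : Poly → Poly → Poly
  []      *ₚ q = []
  (c ∷ p) *ₚ q = map (c *_) q +ₚ (0# ∷ (p *ₚ q))

  const : Carrier → Poly
  const c = c ∷ []

  X : Poly
  X = 0# ∷ 1# ∷ []

  polyRawRing : RawRing a ℓ
  polyRawRing = record
    { Carrier = Poly
    ; _≈_     = _≈ₚ_
    ; _+_     = _+ₚ_
    ; _*_     = _*ₚ_
    ; -_      = map (-_)
    ; 0#      = []
    ; 1#      = const 1#
    }

  ≈ₚ-isEquivalence : IsEquivalence _≈_ → IsEquivalence _≈ₚ_
  ≈ₚ-isEquivalence isEq = record
    { refl  = λ n → refl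
    ; sym   = λ p≈q n → sym (p≈q n)
    ; trans = λ p≈q q≈r n → trans (p≈q n) (q≈r n)
    }
    where open IsEquivalence isEq

-- ℚ[f,g,d] is ((ℚ[f])[g])[d]; the innermost variable is f.
module Pf = Polynomial +-*-rawRing
module Pg = Polynomial Pf.polyRawRing
module Pd = Polynomial Pg.polyRawRing

ℚ[f,g,d]-rawRing : RawRing 0ℓ 0ℓ
ℚ[f,g,d]-rawRing = Pd.polyRawRing

ℚ[f,g,d] : Setoid 0ℓ 0ℓ
ℚ[f,g,d] = record
  { isEquivalence =
      Pd.≈ₚ-isEquivalence (Pg.≈ₚ-isEquivalence (Pf.≈ₚ-isEquivalence ≡.isEquivalence))
  }

constant : ℚ → RawRing.Carrier ℚ[f,g,d]-rawRing
constant c = Pd.const (Pg.const (Pf.const c))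

varF varG varD : RawRing.Carrier ℚ[f,g,d]-rawRing
varF = Pd.const (Pg.const Pf.X)
varG = Pd.const Pg.X
varD = Pd.X

-- Written over any ring R, with ι interpreting the rational coefficients,
-- so that the same formulas give both rational values and the elements
-- of ℚ[f,g,d].

module Solution
  (R : RawRing a ℓ) (ι : ℚ → RawRing.Carrier R)
  (f g d : RawRing.Carrier R) where

  open RawRing R
  open RawSemiringDefinitions rawSemiring using (_^_)

  quad : ℚ → ℚ → ℚ → Carrier
  quad a b c = ι a * f ^ 2 + ι b * (f * g) + ι c * g ^ 2 + d

  x : Vector Carrier 6
  x = fromList
    ( quad   6   12    6  * quad -30    4    2
    ∷ quad  -6    4   10  * quad  30   -4   -2
    ∷ quad  18   20    2  * quad -18   12   -2
    ∷ quad   6   -4  -10  * quad  18  -12    2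
    ∷ quad  -6   20   -6  * quad -18  -20   -2
    ∷ quad   6  -20    6  * quad  -6  -12   -6
    ∷ [] )

  y : Vector Carrier 6
  y = fromList
    ( quad -18   12   -2  * quad  -6    4   10
    ∷ quad   6  -20    6  * quad  18   20    2
    ∷ quad  -6   20   -6  * quad   6   12    6
    ∷ quad  30   -4   -2  * quad  -6  -12   -6
    ∷ quad -30    4    2  * quad   6   -4  -10
    ∷ quad  18  -12    2  * quad -18  -20   -2
    ∷ [] )

module Rationals (f g d : ℚ) = Solution +-*-rawRing (λ c → c) f g d

module Polynomials = Solution ℚ[f,g,d]-rawRing constant varF varG varD

{-# OPTIONS --safe #-}
-- Both x and y factor through the same twelve quadratics, each used once on
-- either side, so the products agree.  The power sums are compared by
-- expanding them as polynomials in f, g and d.  The solution is nontrivial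
-- because x₁ is none of the yⱼ: the coefficient of dfg in x₁ is 16, which it
-- shares only with y₁, and the f⁴ coefficients of x₁ and y₁ are −180 and 108.
module Submission where

open import Defs
open import Algebra.Bundles using (RawRing)
open import Data.Fin.Base using (zero)
open import Data.Nat.Base using (ℕ; _≤_; suc; s≤s)
open import Data.Product.Base using (_×_; _,_)
open import Data.Rational.Base using (ℚ; +-*-rawRing; _*_; 0ℚ; 1ℚ)
import Data.Rational.Literals as ℚLiterals
open import Data.Rational.Properties using (*-1-commutativeMonoid)
open import Data.Rational.Solver using (module +-*-Solver)
open import Data.Unit.Base using (tt)
open import Data.Vec.Functional using (toList; fromList)
open import Data.List.Base using ([]; _∷_)
open import Data.List.Relation.Unary.Any using (here; there)
open import Level using (0ℓ)
open import Relation.Binary.PropositionalEquality using (_≡_; refl)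
open import Relation.Nullary.Negation using (¬_)
open import Algebra.Definitions.RawSemiring (RawRing.rawSemiring +-*-rawRing) using (_^_; sum; product)
open import Data.List.Relation.Binary.Permutation.Setoid ℚ[f,g,d] using (_↭_)
open import Data.List.Relation.Binary.Permutation.Setoid.Properties ℚ[f,g,d] using (∈-resp-↭)
open import Data.List.Membership.Setoid ℚ[f,g,d] using (_∉_; _∈_)
open import Relation.Binary.Bundles using (Setoid)
import Algebra.Definitions.RawSemiring as RawSemiringDefinitions
import Algebra.Solver.CommutativeMonoid as CommutativeMonoidSolver

-- Instantiating Solution at the solver's syntax reifies the formulas for
-- x and y without restating them.

open +-*-Solver using (Polynomial; con; _:+_; _:*_; :-_; _:=_)

syntaxRawRing : ℕ → RawRing 0ℓ 0ℓ
syntaxRawRing n = record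
  { Carrier = Polynomial n
  ; _≈_     = _≡_
  ; _+_     = _:+_
  ; _*_     = _:*_
  ; -_      = :-_
  ; 0#      = con 0ℚ
  ; 1#      = con 1ℚ
  }

-- The exponent is a natural number outside the syntax: for a numeral `r`, `^` unfolds to iterated
-- `:*`, so evaluating the syntax gives back the power sums over the rationals by computation.
power-sums-equation : ℕ → (f g d : Polynomial 3) → Polynomial 3 × Polynomial 3
power-sums-equation r f g d =
  Syntax.sum (λ i → S.x i Syntax.^ r) := Syntax.sum (λ i → S.y i Syntax.^ r)
  where
  module Syntax = RawSemiringDefinitions (RawRing.rawSemiring (syntaxRawRing 3))
  module S = Solution (syntaxRawRing 3) con f g d

power-sums-≡ : ∀ f g d r → 1 ≤ r → r ≤ 4 →
  sum (λ i → Rationals.x f g d i ^ r) ≡ sum (λ i → Rationals.y f g d i ^ r)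
-- The expansion happens in `refl`, which compares the normal forms of both sides; these compute
-- only for a concrete exponent, hence one clause for each.
power-sums-≡ f g d 1 _ _ = +-*-Solver.solve 3 (power-sums-equation 1) refl f g d
power-sums-≡ f g d 2 _ _ = +-*-Solver.solve 3 (power-sums-equation 2) refl f g d
power-sums-≡ f g d 3 _ _ = +-*-Solver.solve 3 (power-sums-equation 3) refl f g d
power-sums-≡ f g d 4 _ _ = +-*-Solver.solve 3 (power-sums-equation 4) refl f g d
power-sums-≡ f g d (suc (suc (suc (suc (suc r))))) _ (s≤s (s≤s (s≤s (s≤s ()))))

-- The factors are numbered as they occur in `x`, and the right side is their arrangement in `y`.
-- Keeping them as variables avoids expanding a polynomial of degree 24 in `f` and `g`.
product-regroup : ∀ p₁ p₂ p₃ p₄ p₅ p₆ p₇ p₈ p₉ p₁₀ p₁₁ p₁₂ →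
  product (fromList
    (p₁ * p₂ ∷ p₃ * p₄ ∷ p₅ * p₆ ∷ p₇ * p₈ ∷ p₉ * p₁₀ ∷ p₁₁ * p₁₂ ∷ []))
  ≡ product (fromList
    (p₆ * p₃ ∷ p₁₁ * p₅ ∷ p₉ * p₁ ∷ p₄ * p₁₂ ∷ p₂ * p₇ ∷ p₈ * p₁₀ ∷ []))
product-regroup = solve 12
  (λ p₁ p₂ p₃ p₄ p₅ p₆ p₇ p₈ p₉ p₁₀ p₁₁ p₁₂ →
    -- The final `id` matches the unit that ends the right fold `product`.
    (p₁ ⊕ p₂) ⊕ (p₃ ⊕ p₄) ⊕ (p₅ ⊕ p₆) ⊕ (p₇ ⊕ p₈) ⊕ (p₉ ⊕ p₁₀) ⊕ (p₁₁ ⊕ p₁₂) ⊕ id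
    ⊜
    (p₆ ⊕ p₃) ⊕ (p₁₁ ⊕ p₅) ⊕ (p₉ ⊕ p₁) ⊕ (p₄ ⊕ p₁₂) ⊕ (p₂ ⊕ p₇) ⊕ (p₈ ⊕ p₁₀) ⊕ id)
  refl
  where
  open CommutativeMonoidSolver *-1-commutativeMonoid

product-≡ : ∀ f g d → product (Rationals.x f g d) ≡ product (Rationals.y f g d)
product-≡ f g d = product-regroup
  (quad   6   12    6) (quad -30    4    2)
  (quad  -6    4   10) (quad  30   -4   -2)
  (quad  18   20    2) (quad -18   12   -2)
  (quad   6   -4  -10) (quad  18  -12    2)
  (quad  -6   20   -6) (quad -18  -20   -2)
  (quad   6  -20    6) (quad  -6  -12   -6)
  where
  open import Agda.Builtin.FromNat using (Number; fromNat)
  open import Agda.Builtin.FromNeg using (Negative; fromNeg)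
  open Rationals f g d using (quad)

  instance
    numberℚ : Number ℚ
    numberℚ = ℚLiterals.number

    negativeℚ : Negative ℚ
    negativeℚ = ℚLiterals.negative

x₁ : Setoid.Carrier ℚ[f,g,d]
x₁ = Polynomials.x zero

-- The indices of a coefficient are the exponents of d, g and f, in this order.
x₁∉y : x₁ ∉ toList Polynomials.y
x₁∉y (here x₁≈y₁)                                         with () ← x₁≈y₁ 0 0 4
x₁∉y (there (here x₁≈y₂))                                 with () ← x₁≈y₂ 1 1 1
x₁∉y (there (there (here x₁≈y₃)))                         with () ← x₁≈y₃ 1 1 1
x₁∉y (there (there (there (here x₁≈y₄))))                 with () ← x₁≈y₄ 1 1 1
x₁∉y (there (there (there (there (here x₁≈y₅)))))         with () ← x₁≈y₅ 1 1 1
x₁∉y (there (there (there (there (there (here x₁≈y₆)))))) with () ← x₁≈y₆ 1 1 1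

mainTheorem9 : ((f g d : ℚ) →
    ((r : ℕ) → 1 ≤ r → r ≤ 4 →
    sum (λ i → Rationals.x f g d i ^ r) ≡ sum (λ i → Rationals.y f g d i ^ r))
    × product (Rationals.x f g d) ≡ product (Rationals.y f g d))
    × ¬ (toList Polynomials.x ↭ toList Polynomials.y)
mainTheorem9 = (λ f g d → power-sums-≡ f g d , product-≡ f g d)
  -- Both `↭` and `∈` compare entries by their coefficients, so the multisets differ as multisets of
  -- polynomials, whatever trailing zeros the lists carry.
  , λ x↭y → x₁∉y (∈-resp-↭ {x = x₁} x↭y x₁∈x)
  where
  x₁∈x : x₁ ∈ toList Polynomials.x
  x₁∈x = here (Setoid.refl ℚ[f,g,d] {x₁})
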